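{- Let $m\in\mathbb{N}$, let $\eta$ be a finite binomid index of length $m$, let $\tilde\eta$ be its lex-minimal extension, and let $(S_i)_{i\ge 1}$ be the sequence of partial sums of $\tilde\eta$. Then for all $k\ge 1$ there exists a sequence of nonnegative integers $(n_i)_{i\le m}\in \mathbf{UKP}[(S_i)_{i\le m};(i)_{i\le m};k]$ such that \[S_k=\sum_{i=1}^m n_iS_i \qquad\text{and}\qquad k=\sum_{i=1}^m n_i\, i .\]
   Context: $\mathbb{N}=\{1,2,3,\dots\}$ and $\mathbb{N}_0=\mathbb{N}\cup\{0\}$. A sequence $(e_i)_{i\le m}$ of nonnegative integers, where $m\in\mathbb{N}$ (finite sequence of length $m$) or $m=\infty$ (infinite sequence indexed by $\mathbb{N}$), is a binomid index if $\sum_{i=n-k+1}^{n}e_i\ge\sum_{i=1}^k e_i$ for all $k,n\in\mathbb{N}$ with $1\le k\le n\le m$. Every finite binomid index $\eta$ extends to an infinite binomid index having $\eta$ as its initial segment; among all such extensions there is a unique lexicographically minimal one, denoted $\tilde\eta$ and called the lex-minimal extension of $\eta$. The partial sums of $(e_i)_{i\ge1}$ are $S_i=e_1+\dots+e_i$. Unbounded knapsack problem: given sequences $v=(v_i)_{i\le m}$, $w=(w_i)_{i\le m}$ of nonnegative integers and $k\in\mathbb{N}$, $\mathbf{UKP}[v;w;k]$ denotes the set of all sequences $(n_i)_{i\le m}$ of nonnegative integers that maximize $\sum_{i=1}^m n_iv_i$ among all sequences of nonnegative integers subject to the constraint $\sum_{i=1}^m n_iw_i\le k$. -}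

module Defs where

open import Data.Fin using (Fin; toℕ; fromℕ<)
open import Data.Nat using (ℕ; zero; suc; _+_; _*_; _∸_; _≤_; _<_; _<?_)
open import Data.Nat.Properties using (+-0-monoid)
open import Data.Product using (_×_; ∃-syntax)
open import Data.Vec.Functional using (Vector)
open import Level using (0ℓ)
open import Relation.Binary using (Rel)
open import Relation.Binary.Construct.Add.Supremum.NonStrict _≤_ using (_≤⁺_)
open import Relation.Binary.PropositionalEquality using (_≡_)
open import Relation.Nullary using (¬_; yes; no)
open import Relation.Nullary.Construct.Add.Supremum using (_⁺; [_]; ⊤⁺)
open import Algebra.Properties.Monoid.Sum +-0-monoid public using (sum; sum-syntax)

-- A length is an element of ℕ ⁺, with ⊤⁺ as infinity. Sequences are stored
-- from position 0, so that the i-th term (i = 1, 2, …) is at position i - 1.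

Index : ℕ ⁺ → Set
Index [ m ] = Fin m
Index ⊤⁺    = ℕ

Sequence : ℕ ⁺ → Set
Sequence l = Index l → ℕ

-- term l e i is eᵢ, counting from 1. The value 0 outside 1 ≤ i ≤ l is junk.

term : ∀ l → Sequence l → ℕ → ℕ
term l     e zero    = 0
term [ m ] e (suc i) with i <? m
... | yes i<m = e (fromℕ< i<m)
... | no  _   = 0
term ⊤⁺    e (suc i) = e i

-- f a + f (a + 1) + … + f b, both ends included; empty when b < a.

sumFromTo : ℕ → ℕ → (ℕ → ℕ) → ℕ
sumFromTo a b f = ∑[ j < suc b ∸ a ] f (a + toℕ j)

infixl 10 sumFromTo
syntax sumFromTo a b (λ i → x) = ∑[ i from a to b ] x

IsBinomidIndex : ∀ l → Sequence l → Set
IsBinomidIndex l e = ∀ k n → 1 ≤ k → k ≤ n → [ n ] ≤⁺ l →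
  (∑[ i from 1 to k ] term l e i) ≤ (∑[ i from suc (n ∸ k) to n ] term l e i)

infix 4 _<lex_

_<lex_ : Rel (Sequence ⊤⁺) 0ℓ
e <lex f = ∃[ i ] (∀ j → j < i → e j ≡ f j) × e i < f i

record IsBinomidExtension {m} (η : Sequence [ m ]) (e : Sequence ⊤⁺) : Set where
  field
    isBinomidIndex : IsBinomidIndex ⊤⁺ e
    initialSegment : ∀ (i : Fin m) → e (toℕ i) ≡ η i

-- The lexicographic order is classically total, so "no extension is strictly
-- smaller" says that e is the least one; it avoids asking for a decision
-- between equality and strict inequality of infinite sequences.

record IsLexMinimalExtension {m} (η : Sequence [ m ]) (e : Sequence ⊤⁺) : Set where
  field
    isBinomidExtension : IsBinomidExtension η e
    minimal            : ∀ f → IsBinomidExtension η f → ¬ (f <lex e)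

partialSum : Sequence ⊤⁺ → ℕ → ℕ
partialSum e k = ∑[ i from 1 to k ] term ⊤⁺ e i

record UKP {m} (v w : Vector ℕ m) (k : ℕ) (n : Vector ℕ m) : Set where
  field
    feasible : ∑[ i < m ] (n i * w i) ≤ k
    optimal  : ∀ (n′ : Vector ℕ m) → ∑[ i < m ] (n′ i * w i) ≤ k →
               ∑[ i < m ] (n′ i * v i) ≤ ∑[ i < m ] (n i * v i)

{-# OPTIONS --safe #-}

-- In terms of partial sums, being a binomid index means being superadditive.
-- Let k > m. If no splitting k = a + b into positive parts had S a + S b = S k,
-- then decreasing the single value S k by one would preserve superadditivity and
-- give a lexicographically smaller extension. Hence S k = S a + S b for some such
-- splitting, and by strong induction every k is a combination of 1, …, m along
-- which S is additive. Superadditivity makes any such combination optimal.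

module Submission where

open import Defs
open import Algebra.Properties.CommutativeMonoid.Sum using (∑-distrib-+)
open import Algebra.Properties.Monoid.Sum using (sum-cong-≗; sum-replicate-zero)
open import Data.Empty using (⊥-elim)
open import Data.Fin using (Fin; toℕ; fromℕ<)
open import Data.Fin.Properties using (toℕ-fromℕ<; toℕ<n)
open import Data.Nat using (ℕ; zero; suc; pred; _+_; _*_; _∸_; _≤_; _<_; z≤n; s≤s; _≟_; _≤?_)
open import Data.Nat.Induction using (<-rec)
open import Data.Nat.Properties
open import Data.Product using (_×_; _,_; ∃-syntax; Σ-syntax)
open import Data.Vec.Functional using (Vector)
open import Relation.Binary.Construct.Add.Supremum.NonStrict _≤_ using (_≤⊤⁺)
open import Relation.Binary.PropositionalEquality
  using (_≡_; _≢_; refl; sym; trans; cong; cong₂; subst; subst₂)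
open import Relation.Nullary using (¬_; yes; no)
open import Relation.Nullary.Construct.Add.Supremum using ([_]; ⊤⁺)
open import Relation.Nullary.Decidable using (decidable-stable; _×-dec_)

record Superadditive (S : ℕ → ℕ) : Set where
  field
    zero-≡  : S 0 ≡ 0
    +-super : ∀ a b → S a + S b ≤ S (a + b)

  mono : ∀ {a b} → a ≤ b → S a ≤ S b
  mono {a} {b} a≤b = begin
    S a               ≤⟨ m≤m+n (S a) (S (b ∸ a)) ⟩
    S a + S (b ∸ a)   ≤⟨ +-super a (b ∸ a) ⟩
    S (a + (b ∸ a))   ≡⟨ cong S (m+[n∸m]≡n a≤b) ⟩
    S b               ∎
    where open ≤-Reasoning

  *-super : ∀ c a → c * S a ≤ S (c * a)
  *-super zero    a = z≤n
  *-super (suc c) a = ≤-trans (+-monoʳ-≤ (S a) (*-super c a)) (+-super a (c * a))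

  -- Superadditivity iterated over copies of an item and then over items. It bounds the value of a
  -- packing by `S` of its total weight.
  ∑-super : ∀ {m} (n w : Vector ℕ m) → ∑[ i < m ] (n i * S (w i)) ≤ S (∑[ i < m ] (n i * w i))
  ∑-super {zero}  n w = z≤n
  ∑-super {suc m} n w = ≤-trans
    (+-mono-≤ (*-super (n Fin.zero) (w Fin.zero)) (∑-super (λ i → n (Fin.suc i)) (λ i → w (Fin.suc i))))
    (+-super (n Fin.zero * w Fin.zero) _)

open Superadditive

partialSum-+ : ∀ e a b → partialSum e (a + b) ≡ partialSum e a + ∑[ j < b ] e (a + toℕ j)
partialSum-+ e zero    b = refl
partialSum-+ e (suc a) b = trans
  (cong (e 0 +_) (partialSum-+ (λ i → e (suc i)) a b))
  (sym (+-assoc (e 0) _ _))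

partialSum-suc : ∀ e n → partialSum e (suc n) ≡ partialSum e n + e n
partialSum-suc e n = trans (cong (partialSum e) (+-comm 1 n)) (trans (partialSum-+ e n 1)
  (cong (partialSum e n +_) (trans (+-identityʳ _) (cong e (+-identityʳ n)))))

-- The binomid condition at length `b` and end `a + b` compares the first `b` terms with the `b`
-- terms after position `a`; adding the first `a` terms to both sides gives the claim. That
-- condition needs `1 ≤ b`, hence the separate case `b = 0`.
binomid⇒superadditive : ∀ e → IsBinomidIndex ⊤⁺ e → Superadditive (partialSum e)
binomid⇒superadditive e bin .zero-≡        = refl
binomid⇒superadditive e bin .+-super a zero
  rewrite +-identityʳ a | +-identityʳ (partialSum e a) = ≤-refl
binomid⇒superadditive e bin .+-super a b@(suc _) = begin
  partialSum e a + partialSum e b                 ≤⟨ +-monoʳ-≤ (partialSum e a) last-b-terms ⟩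
  partialSum e a + ∑[ j < b ] e (a + toℕ j)       ≡⟨ partialSum-+ e a b ⟨
  partialSum e (a + b)                            ∎
  where
  open ≤-Reasoning
  last-b-terms : partialSum e b ≤ ∑[ j < b ] e (a + toℕ j)
  last-b-terms = subst₂ (λ c d → partialSum e b ≤ ∑[ j < d ] e (c + toℕ j))
    (m+n∸n≡m a b)
    (trans (cong (a + b ∸_) (m+n∸n≡m a b)) (m+n∸m≡n a b))
    (bin b (a + b) (s≤s z≤n) (m≤n+m b a) ([ a + b ] ≤⊤⁺))

superadditive⇒binomid : ∀ e → Superadditive (partialSum e) → IsBinomidIndex ⊤⁺ e
superadditive⇒binomid e sup k n _ k≤n _ =
  subst (λ d → partialSum e k ≤ ∑[ j < d ] e (n ∸ k + toℕ j)) (sym (m∸[m∸n]≡n k≤n))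
    (+-cancelˡ-≤ (partialSum e (n ∸ k)) _ _ (begin
      partialSum e (n ∸ k) + partialSum e k                       ≤⟨ sup .+-super (n ∸ k) k ⟩
      partialSum e (n ∸ k + k)                                    ≡⟨ partialSum-+ e (n ∸ k) k ⟩
      partialSum e (n ∸ k) + ∑[ j < k ] e (n ∸ k + toℕ j)         ∎))
  where open ≤-Reasoning

-- Inverse to `partialSum` on superadditive sequences: these are monotone, so truncated subtraction
-- loses nothing.
difference : (ℕ → ℕ) → Sequence ⊤⁺
difference T i = T (suc i) ∸ T i

difference-partialSum : ∀ e i → difference (partialSum e) i ≡ e i
difference-partialSum e i =
  trans (cong (_∸ partialSum e i) (partialSum-suc e i)) (m+n∸m≡n (partialSum e i) (e i))

partialSum-difference : ∀ {T} → Superadditive T → ∀ n → partialSum (difference T) n ≡ T n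
partialSum-difference     sup zero    = sym (sup .zero-≡)
partialSum-difference {T} sup (suc n) = trans (partialSum-suc (difference T) n) (trans
  (cong (_+ difference T n) (partialSum-difference sup n))
  (m+[n∸m]≡n (mono sup (n≤1+n n))))

difference-binomid : ∀ T → Superadditive T → IsBinomidIndex ⊤⁺ (difference T)
difference-binomid T sup = superadditive⇒binomid (difference T) record
  { zero-≡  = refl
  ; +-super = λ a b → subst₂ _≤_
      (sym (cong₂ _+_ (partialSum-difference sup a) (partialSum-difference sup b)))
      (sym (partialSum-difference sup (a + b)))
      (sup .+-super a b)
  }

lowerAt : ℕ → (ℕ → ℕ) → ℕ → ℕ
lowerAt k S j with j ≟ k
... | yes _ = pred (S j)
... | no  _ = S j

lowerAt-≡ : ∀ k S → lowerAt k S k ≡ pred (S k)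
lowerAt-≡ k S with k ≟ k
... | yes _  = refl
... | no k≢k = ⊥-elim (k≢k refl)

lowerAt-≢ : ∀ k {j} S → j ≢ k → lowerAt k S j ≡ S j
lowerAt-≢ k {j} S j≢k with j ≟ k
... | yes j≡k = ⊥-elim (j≢k j≡k)
... | no  _   = refl

lowerAt-≤ : ∀ k S j → lowerAt k S j ≤ S j
lowerAt-≤ k S j with j ≟ k
... | yes _ = pred[n]≤n
... | no  _ = ≤-refl

-- The bound `a < k` both keeps `k ∸ a` positive and makes this a finite search, hence decidable.
Splits : (ℕ → ℕ) → ℕ → Set
Splits S k = ∃[ a ] a < k × 0 < a × S a + S (k ∸ a) ≡ S k

nonsplit⇒< : ∀ S → Superadditive S → ∀ a b → 0 < a → 0 < b → ¬ Splits S (a + b) →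
             S a + S b < S (a + b)
nonsplit⇒< S sup a b 0<a 0<b nonsplit = ≤∧≢⇒< (sup .+-super a b) λ eq → nonsplit
  (a , m<m+n a 0<b , 0<a , trans (cong (λ c → S a + S c) (m+n∸m≡n a b)) eq)

-- Lowering on the left side of an inequality only helps. On the right it matters only for
-- `a + b = k`, where the lack of a splitting makes the inequality strict, so that one unit can be
-- spared.
lowerAt-superadditive : ∀ S {k} → Superadditive S → ¬ Splits S k → Superadditive (lowerAt k S)
lowerAt-superadditive S {k} sup nonsplit = record { zero-≡ = zero-≡′ ; +-super = +-super′ }
  where
  S′ : ℕ → ℕ
  S′ = lowerAt k S

  zero-≡′ : S′ 0 ≡ 0
  zero-≡′ = n≤0⇒n≡0 (subst (S′ 0 ≤_) (sup .zero-≡) (lowerAt-≤ k S 0))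

  +-super′ : ∀ a b → S′ a + S′ b ≤ S′ (a + b)
  -- A part equal to 0 is no splitting, so `nonsplit` says nothing here; both sides are equal
  -- instead.
  +-super′ zero      b    rewrite zero-≡′ = ≤-refl
  +-super′ a         zero rewrite zero-≡′ | +-identityʳ a | +-identityʳ (S′ a) = ≤-refl
  +-super′ a@(suc _) b@(suc _) = ≤-trans (+-mono-≤ (lowerAt-≤ k S a) (lowerAt-≤ k S b)) bound
    where
    bound : S a + S b ≤ S′ (a + b)
    bound with a + b ≟ k
    ... | yes refl = <⇒≤pred (nonsplit⇒< S sup a b (s≤s z≤n) (s≤s z≤n) nonsplit)
    ... | no  _    = sup .+-super a b

-- Lowering `S k` changes no term before position `p = k - 1`, and `m ≤ p`, so the prefix `η`
-- survives. The term at `p` drops; that the next one grows is invisible to the lexicographic order.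
lexMinimal⇒splits : ∀ {m} {η : Sequence [ m ]} e → IsLexMinimalExtension η e →
                    ∀ {k} → m < k → 1 < k → Splits (partialSum e) k
lexMinimal⇒splits {m} e lexmin {suc p} m<k 1<k@(s≤s 0<p) = decidable-stable
  -- Minimality is a negative statement and refutes only the absence of a splitting; decidability
  -- turns this into an actual splitting.
  (anyUpTo? (λ a → (1 ≤? a) ×-dec (S a + S (k ∸ a) ≟ S k)) k) contra
  where
  open IsLexMinimalExtension lexmin
  open IsBinomidExtension isBinomidExtension
  k : ℕ
  k = suc p
  S S′ : ℕ → ℕ
  S  = partialSum e
  S′ = lowerAt k S

  sup : Superadditive S
  sup = binomid⇒superadditive e isBinomidIndex

  below : ∀ j → j < p → difference S′ j ≡ e j
  below j j<p = trans
    (cong₂ _∸_ (lowerAt-≢ k S (<⇒≢ (s≤s j<p))) (lowerAt-≢ k S (<⇒≢ (m<n⇒m<1+n j<p))))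
    (difference-partialSum e j)

  contra : ¬ ¬ Splits S k
  contra nonsplit = minimal (difference S′)
    (record
      { isBinomidIndex = difference-binomid S′ (lowerAt-superadditive S sup nonsplit)
      ; initialSegment = λ i →
          trans (below (toℕ i) (<-≤-trans (toℕ<n i) (≤-pred m<k))) (initialSegment i)
      })
    (p , below , at-p)
    where
    open ≤-Reasoning
    Sp<Sk : S p < S k
    -- Uses the parts 1 and `p`. Strictness ensures that `pred` really lowers `S k` and that
    -- `pred (S k) ∸ S p` is not truncated.
    Sp<Sk = ≤-<-trans (m≤n+m (S p) (S 1)) (nonsplit⇒< S sup 1 p (s≤s z≤n) 0<p nonsplit)

    at-p : difference S′ p < e p
    at-p = begin-strict
      S′ k ∸ S′ p         ≡⟨ cong₂ _∸_ (lowerAt-≡ k S) (lowerAt-≢ k S (<⇒≢ (n<1+n p))) ⟩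
      pred (S k) ∸ S p    <⟨ ∸-monoˡ-< (pred-below Sp<Sk) (<⇒≤pred Sp<Sk) ⟩
      S k ∸ S p           ≡⟨ difference-partialSum e p ⟩
      e p                 ∎
      where
      pred-below : ∀ {x y} → x < y → pred y < y
      pred-below (s≤s _) = ≤-refl

δ : ∀ {m} → Fin m → Vector ℕ m
δ Fin.zero    Fin.zero    = 1
δ Fin.zero    (Fin.suc j) = 0
δ (Fin.suc i) Fin.zero    = 0
δ (Fin.suc i) (Fin.suc j) = δ i j

∑-δ : ∀ {m} (i : Fin m) (f : Vector ℕ m) → ∑[ j < m ] (δ i j * f j) ≡ f i
∑-δ {suc m} Fin.zero    f = trans
  (cong₂ _+_ (+-identityʳ (f Fin.zero)) (sum-replicate-zero +-0-monoid m)) (+-identityʳ (f Fin.zero))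
∑-δ         (Fin.suc i) f = ∑-δ i (λ j → f (Fin.suc j))

∑-+-* : ∀ {m} (n n′ f : Vector ℕ m) →
        ∑[ i < m ] ((n i + n′ i) * f i) ≡ ∑[ i < m ] (n i * f i) + ∑[ i < m ] (n′ i * f i)
∑-+-* n n′ f = trans (sum-cong-≗ +-0-monoid (λ i → *-distribʳ-+ (f i) (n i) (n′ i)))
  (∑-distrib-+ +-0-commutativeMonoid (λ i → n i * f i) (λ i → n′ i * f i))

-- The same multiplicities must give both the value and the weight.
Representable : ℕ → (ℕ → ℕ) → ℕ → Set
Representable m S k = Σ[ n ∈ Vector ℕ m ]
    S k ≡ ∑[ i < m ] (n i * S (suc (toℕ i)))
  × k ≡ ∑[ i < m ] (n i * suc (toℕ i))

representable-≤ : ∀ {m k} S → 0 < k → k ≤ m → Representable m S k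
representable-≤ {k = suc p} S _ p<m = δ i
  , sym (trans (∑-δ i (λ j → S (suc (toℕ j)))) (cong (λ j → S (suc j)) (toℕ-fromℕ< p<m)))
  , sym (trans (∑-δ i (λ j → suc (toℕ j))) (cong suc (toℕ-fromℕ< p<m)))
  -- One copy of the item of weight `k = suc p`, stored at position `p`.
  where i = fromℕ< p<m

representable-+ : ∀ {m a b} S → S a + S b ≡ S (a + b) →
                  Representable m S a → Representable m S b → Representable m S (a + b)
representable-+ S eq (n , Sa≡ , a≡) (n′ , Sb≡ , b≡) = (λ i → n i + n′ i)
  , trans (sym eq) (trans (cong₂ _+_ Sa≡ Sb≡) (sym (∑-+-* n n′ (λ i → S (suc (toℕ i))))))
  , trans (cong₂ _+_ a≡ b≡) (sym (∑-+-* n n′ (λ i → suc (toℕ i))))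

lexMinimal⇒representable : ∀ {m} → 1 ≤ m → ∀ {η : Sequence [ m ]} e →
                           IsLexMinimalExtension η e →
                           ∀ k → 1 ≤ k → Representable m (partialSum e) k
lexMinimal⇒representable {m} 1≤m e lexmin =
  <-rec (λ k → 1 ≤ k → Representable m S k) step
  where
  S : ℕ → ℕ
  S = partialSum e
  step : ∀ k → (∀ {j} → j < k → 1 ≤ j → Representable m S j) → 1 ≤ k → Representable m S k
  step k rec 1≤k with k ≤? m
  ... | yes k≤m = representable-≤ S 1≤k k≤m
  ... | no  k≰m with lexMinimal⇒splits e lexmin (≰⇒> k≰m) (≤-<-trans 1≤m (≰⇒> k≰m))
  ... | a , a<k , 0<a , eq = subst (Representable m S) a+b≡k
    (representable-+ S (trans eq (cong S (sym a+b≡k)))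
      (rec a<k 0<a)
      -- `0 < a` makes `k ∸ a` smaller than `k`, and `a < k` makes it positive.
      (rec (∸-monoʳ-< 0<a (<⇒≤ a<k)) (m<n⇒0<n∸m a<k)))
    where a+b≡k = m+[n∸m]≡n (<⇒≤ a<k)

proposition2p3 : ∀ (m : ℕ) → 1 ≤ m →
    ∀ (η : Sequence [ m ]) → IsBinomidIndex [ m ] η →
    ∀ (η~ : Sequence ⊤⁺) → IsLexMinimalExtension η η~ →
    let S = partialSum η~ in
    ∀ (k : ℕ) → 1 ≤ k →
    ∃[ n ] UKP {m} (λ i → S (suc (toℕ i))) (λ i → suc (toℕ i)) k n
    × S k ≡ ∑[ i < m ] (n i * S (suc (toℕ i)))
    × k ≡ ∑[ i < m ] (n i * suc (toℕ i))
proposition2p3 m 1≤m η _ η~ lexmin k 1≤k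
  with n , Sk≡ , k≡ ← lexMinimal⇒representable 1≤m η~ lexmin k 1≤k =
  n , record { feasible = ≤-reflexive (sym k≡) ; optimal = optimal } , Sk≡ , k≡
  where
  S : ℕ → ℕ
  S = partialSum η~
  sup : Superadditive S
  sup = binomid⇒superadditive η~
    (IsBinomidExtension.isBinomidIndex (IsLexMinimalExtension.isBinomidExtension lexmin))
  optimal : ∀ n′ → ∑[ i < m ] (n′ i * suc (toℕ i)) ≤ k →
            ∑[ i < m ] (n′ i * S (suc (toℕ i))) ≤ ∑[ i < m ] (n i * S (suc (toℕ i)))
  -- The value of `n′` is at most `S` of its weight, hence at most `S k`, which is the value of `n`.
  optimal n′ feasible = subst (∑[ i < m ] (n′ i * S (suc (toℕ i))) ≤_) Sk≡
    (≤-trans (∑-super sup n′ (λ i → suc (toℕ i))) (mono sup feasible))
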